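{- Let $k\geq 1$ be an integer. Every strongly $452k$-connected tournament is $k$-linked.
   Context: A tournament is a directed graph with exactly one directed edge between any two distinct vertices. A directed graph is strongly connected if for any two vertices $u,v$ there is a directed path from $u$ to $v$; it is strongly $k$-connected if it remains strongly connected after the removal of any set of at most $k-1$ vertices. A directed graph is $k$-linked if for any two disjoint sets of vertices $\{x_1,\dots,x_k\}$ and $\{y_1,\dots,y_k\}$ there are vertex-disjoint directed paths $P_1,\dots,P_k$ such that $P_i$ goes from $x_i$ to $y_i$ for each $i$. -}

module Defs where

open import Data.Nat using (ℕ; _≤_; _<_; _∸_)
open import Data.Fin using (Fin)
open import Data.List using (List; []; _∷_; length)
open import Data.List.Membership.Propositional using (_∈_; _∉_)
open import Data.List.Relation.Unary.Unique.Propositional using (Unique)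
open import Data.List.Relation.Unary.All using (All)
open import Data.Product using (Σ; _×_; ∃)
open import Data.Sum using (_⊎_)
open import Relation.Nullary using (¬_)
open import Relation.Binary.PropositionalEquality using (_≡_; _≢_)

record Digraph : Set₁ where
  field
    n   : ℕ
    Arc : Fin n → Fin n → Set

open Digraph public

IsTournament : Digraph → Set
IsTournament D =
  (∀ u → ¬ Arc D u u) ×
  (∀ u v → u ≢ v → (Arc D u v ⊎ Arc D v u)) ×
  (∀ u v → Arc D u v → ¬ Arc D v u)

data Walk (D : Digraph) : List (Fin (n D)) → Set where
  single : ∀ v → Walk D (v ∷ [])
  step   : ∀ {u v vs} → Arc D u v → Walk D (v ∷ vs) → Walk D (u ∷ v ∷ vs)

last : ∀ {A : Set} → A → List A → A
last d []       = d
last d (x ∷ xs) = last x xs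

IsPath : (D : Digraph) → Fin (n D) → Fin (n D) → List (Fin (n D)) → Set
IsPath D x y P =
  Σ (List (Fin (n D))) (λ rest → P ≡ x ∷ rest) ×
  last x P ≡ y × Unique P × Walk D P

StrongAvoiding : (D : Digraph) → List (Fin (n D)) → Set
StrongAvoiding D S =
  ∀ u v → u ∉ S → v ∉ S →
  Σ (List (Fin (n D))) (λ P → IsPath D u v P × All (λ w → w ∉ S) P)

StronglyConnectedK : ℕ → Digraph → Set
StronglyConnectedK k D =
  k < n D ×
  (∀ (S : List (Fin (n D))) → Unique S → length S ≤ k ∸ 1 → StrongAvoiding D S)

KLinked : ℕ → Digraph → Set
KLinked k D =
  ∀ (x y : Fin k → Fin (n D)) →
  (∀ i j → x i ≡ x j → i ≡ j) →
  (∀ i j → y i ≡ y j → i ≡ j) →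
  (∀ i j → x i ≢ y j) →
  Σ (Fin k → List (Fin (n D))) (λ P →
    (∀ i → IsPath D (x i) (y i) (P i)) ×
    (∀ i j → i ≢ j → ∀ w → w ∈ P i → w ∉ P j))

{-# OPTIONS --safe #-}
-- A vertex v of least out-degree d outside F, a vertex w beating at least half of the
-- out-neighbours of v, and a third one halving again form a funnel: all vertices outside F but at most
-- d/4 can walk into its last vertex, the sink. Build 3k disjoint funnels, and dually 3k disjoint
-- ones for the reversed tournament. A vertex x̂ outside them has out-degree at least d, so averaging
-- gives it an out-neighbour z that is exceptional for at most k of the 3k funnels; reserve a route
-- x_i → x̂_i → z_i for each i, and dually for y_i. By Menger's theorem 3k disjoint paths that avoid
-- everything reserved join the sinks to the dual sinks. Each i rules out at most 2k of these paths,
-- so distinct ones can be chosen greedily.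
module Submission where

open import Defs
open import Data.Nat using (ℕ; zero; suc; pred; NonZero; >-nonZero; _+_; _*_; _∸_; _≤_; _<_; z≤n; s≤s)
open import Data.Nat.Properties hiding (_≟_)
open import Algebra.Properties.CommutativeSemigroup +-commutativeSemigroup using (interchange; x∙yz≈y∙xz)
open import Data.Nat.ListAction using (sum)
open import Data.Nat.Tactic.RingSolver using (solve-∀)
open import Data.Fin using (Fin; zero; suc; inject≤)
open import Data.Fin.Properties using (_≟_; inject≤-injective)
open import Data.List using (List; []; _∷_; _++_; length; map; filter; tabulate; concat; lookup; deduplicate; allFin; cartesianProduct)
open import Data.List.Extrema ≤-totalOrder using (argmin; argmin-all; f[argmin]≤f[xs])
open import Data.List.Properties using (length-++; length-map; length-tabulate; length-filter)
open import Data.List.Membership.Propositional using (_∈_; _∉_; find)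
open import Data.List.Membership.Propositional.Properties
open import Data.List.Relation.Unary.Any using (here; there)
open import Data.List.Relation.Unary.All as All using (All; [])
open import Data.List.Relation.Unary.All.Properties using (all-filter; ¬Any⇒All¬; ¬All⇒Any¬)
open import Data.List.Relation.Unary.AllPairs using ([]; _∷_)
open import Data.List.Relation.Unary.Unique.Propositional using (Unique)
import Data.List.Relation.Unary.Unique.Propositional.Properties as Unique
open import Data.List.Relation.Unary.Unique.DecPropositional.Properties using (deduplicate-!)
open import Data.List.Relation.Binary.Subset.Propositional using (_⊆_)
open import Data.Product using (Σ; ∃; _×_; _,_; proj₁; proj₂; map₂)
open import Data.Sum using (_⊎_; inj₁; inj₂; [_,_]′)
open import Function using (_∘_; id; flip; case_of_)
open import Function.Definitions using (Injective)
open import Relation.Nullary using (¬_; Dec; yes; no; contradiction)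
open import Relation.Nullary.Decidable using (_×-dec_; ¬?)
open import Relation.Unary using (Decidable)
open import Relation.Binary.PropositionalEquality using (_≡_; _≢_; refl; sym; trans; cong; cong₂; subst; subst₂)

-- The detour through x̂_i is needed because the terminals lie in every forbidden set F, so the
-- minimality of v says nothing about their out-degrees; it does bound from below the out-degree of
-- a vertex outside F. The factor 3 comes from the quarter: at most 24k reserved vertices, again at
-- most a quarter of the out-degree, are struck from the out-neighbours of x̂_i. Three quarters
-- remain as candidates for z_i, each exceptional set covers at most a third of them, and on average
-- a candidate lies in at most k of the 3k sets. When both ends have ruled out k links each, k links
-- remain for i, and at most k - 1 of these are already given away. Which feeders will be used is
-- known only once the links are assigned, so all of them are reserved before Menger's theorem is
-- applied. The dual funnels are built second and avoid all of the first construction (3k sinks, 8k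
-- block vertices, 2k terminals). With 9k members and 2k lead vertices of their own this gives the
-- budget 24k.

module _ {n : ℕ} where
  open import Data.List.Membership.DecPropositional (_≟_ {n}) public using (_∈?_; _∉?_)

-- Counting in lists

unique-⊆⇒length≤ : {A : Set} {xs ys : List A} → Unique xs → xs ⊆ ys → length xs ≤ length ys
unique-⊆⇒length≤ {xs = []} _ _ = z≤n
unique-⊆⇒length≤ {xs = x ∷ xs} (x∉xs ∷ u) xs⊆ys with ∈-∃++ (xs⊆ys (here refl))
... | as , bs , refl = begin
  suc (length xs)               ≤⟨ s≤s (unique-⊆⇒length≤ u xs⊆as++bs) ⟩
  suc (length (as ++ bs))       ≡⟨ cong suc (length-++ as) ⟩
  suc (length as + length bs)   ≡⟨ +-suc (length as) (length bs) ⟨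
  length as + suc (length bs)   ≡⟨ length-++ as ⟨
  length (as ++ x ∷ bs)         ∎
  where
  open ≤-Reasoning
  xs⊆as++bs : xs ⊆ as ++ bs
  xs⊆as++bs z∈xs with ∈-++⁻ as (xs⊆ys (there z∈xs))
  ... | inj₁ z∈as         = ∈-++⁺ˡ z∈as
  ... | inj₂ (here refl)  = contradiction refl (All.lookup x∉xs z∈xs)
  ... | inj₂ (there z∈bs) = ∈-++⁺ʳ as z∈bs

∃-outside : ∀ {n} {xs : List (Fin n)} ys → Unique xs → length ys < length xs →
            ∃ λ x → x ∈ xs × x ∉ ys
∃-outside {xs = xs} ys u ys<xs with All.all? (_∈? ys) xs
... | yes xs⊆ys = contradiction (unique-⊆⇒length≤ u (All.lookup xs⊆ys)) (<⇒≱ ys<xs)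
... | no ¬xs⊆ys = find (¬All⇒Any¬ (_∈? ys) xs ¬xs⊆ys)

-- An entry of L missed by `f` would give k + 1 distinct entries. The lemma is applied to end
-- vertices of linkages: k disjoint paths into a set of at most k vertices use all of it.
injective⇒covers : ∀ {n k} {f : Fin k → Fin n} {L} → Injective _≡_ _≡_ f →
                   (∀ i → f i ∈ L) → length L ≤ k → ∀ {l} → l ∈ L → ∃ λ i → f i ≡ l
injective⇒covers {k = k} {f} {L} inj f∈L L≤k {l} l∈L with l ∈? tabulate f
... | yes l∈f = map₂ sym (∈-tabulate⁻ l∈f)
... | no  l∉f = contradiction
  (unique-⊆⇒length≤ (¬Any⇒All¬ _ l∉f ∷ Unique.tabulate⁺ inj)
    λ { (here refl) → l∈L ; (there v∈f) → let i , v≡ = ∈-tabulate⁻ v∈f in subst (_∈ L) (sym v≡) (f∈L i) })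
  (<⇒≱ (s≤s (≤-trans L≤k (≤-reflexive (sym (length-tabulate f))))))

unique⇒lookup-injective : {A : Set} {xs : List A} → Unique xs → Injective _≡_ _≡_ (lookup xs)
unique⇒lookup-injective {xs = x ∷ xs} u {zero} {zero} _ = refl
unique⇒lookup-injective {xs = x ∷ xs} (x∉ ∷ u) {zero} {suc j} eq = contradiction eq (All.lookup x∉ (∈-lookup j))
unique⇒lookup-injective {xs = x ∷ xs} (x∉ ∷ u) {suc i} {zero} eq = contradiction (sym eq) (All.lookup x∉ (∈-lookup i))
unique⇒lookup-injective {xs = x ∷ xs} (x∉ ∷ u) {suc i} {suc j} eq = cong suc (unique⇒lookup-injective u eq)

length-concat-tabulate : {A : Set} {c : ℕ} → ∀ m (f : Fin m → List A) → (∀ i → length (f i) ≤ c) →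
                         length (concat (tabulate f)) ≤ m * c
length-concat-tabulate zero    f f≤c = z≤n
length-concat-tabulate (suc m) f f≤c =
  ≤-trans (≤-reflexive (length-++ (f zero)))
          (+-mono-≤ (f≤c zero) (length-concat-tabulate m (f ∘ suc) (f≤c ∘ suc)))

∈-concat-tabulate : ∀ {A : Set} {m} (f : Fin m → List A) {v} i → v ∈ f i → v ∈ concat (tabulate f)
∈-concat-tabulate f i v∈ = ∈-concat⁺′ v∈ (∈-tabulate⁺ i)

-- Greedy choice with each chosen vertex added to the forbidden list. The last choice faces only r -
-- 1 earlier ones besides `F₀`, hence `suc B` in the bound.
distinctRepresentatives : ∀ {n} B r (G : Fin r → Fin n → Set) →
  (∀ i F → length F ≤ B → ∃ λ v → G i v × v ∉ F) →
  ∀ F₀ → r + length F₀ ≤ suc B →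
  ∃ λ (f : Fin r → Fin n) → (∀ i → G i (f i)) × Injective _≡_ _≡_ f × (∀ i → f i ∉ F₀)
distinctRepresentatives B zero G pick F₀ _ = (λ ()) , (λ ()) , (λ { {()} }) , (λ ())
distinctRepresentatives {n} B (suc r) G pick F₀ (s≤s r+F₀≤B)
  with v , Gv , v∉F₀ ← pick zero F₀ (m+n≤o⇒n≤o r r+F₀≤B)
  with f , Gf , f-inj , f∉ ← distinctRepresentatives B r (G ∘ suc) (pick ∘ suc) (v ∷ F₀)
         (≤-trans (≤-reflexive (+-suc r (length F₀))) (s≤s r+F₀≤B))
  = g , (λ { zero → Gv ; (suc i) → Gf i }) , inj , λ { zero → v∉F₀ ; (suc i) → f∉ i ∘ there }
  where
  g : Fin (suc r) → Fin n
  g zero    = v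
  g (suc i) = f i
  inj : Injective _≡_ _≡_ g
  inj {zero}  {zero}  _  = refl
  inj {zero}  {suc j} eq = contradiction (here (sym eq)) (f∉ j)
  inj {suc i} {zero}  eq = contradiction (here eq) (f∉ i)
  inj {suc i} {suc j} eq = cong suc (f-inj eq)

module _ {A : Set} where

  -- The factor q expresses the bound c / q on each term without division.
  sum-≤ : ∀ q c (f : A → ℕ) as → (∀ {a} → a ∈ as → q * f a ≤ c) → q * sum (map f as) ≤ length as * c
  sum-≤ q c f []       _  = ≤-reflexive (*-zeroʳ q)
  sum-≤ q c f (a ∷ as) f≤ = ≤-trans (≤-reflexive (*-distribˡ-+ q (f a) _))
                                    (+-mono-≤ (f≤ (here refl)) (sum-≤ q c f as (f≤ ∘ there)))

  sum-map-+ : ∀ (f g : A → ℕ) as → sum (map (λ a → f a + g a) as) ≡ sum (map f as) + sum (map g as)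
  sum-map-+ f g []       = refl
  sum-map-+ f g (a ∷ as) rewrite sum-map-+ f g as = interchange (f a) (g a) _ _

  ∃-≤-average : ∀ c (f : A → ℕ) as → 0 < length as → sum (map f as) ≤ length as * c →
                ∃ λ a → a ∈ as × f a ≤ c
  ∃-≤-average c f (a ∷ as) _ ≤c with f a ≤? c
  ... | yes fa≤c = a , here refl , fa≤c
  ... | no  fa≰c with as
  ...   | [] = contradiction (≤-trans (m≤m+n (f a) 0) (≤-trans ≤c (≤-reflexive (+-identityʳ c)))) fa≰c
  ...   | as@(_ ∷ _) =
    let b , b∈ , fb≤c = ∃-≤-average c f as (s≤s z≤n)
                          (+-cancelˡ-≤ c _ _ (≤-trans (+-monoˡ-≤ (sum (map f as)) (<⇒≤ (≰⇒> fa≰c))) ≤c))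
    in b , there b∈ , fb≤c

  length-filter-disjoint : {P Q : A → Set} (P? : Decidable P) (Q? : Decidable Q) →
    (∀ {a} → P a → ¬ Q a) → ∀ as → length (filter P? as) + length (filter Q? as) ≤ length as
  length-filter-disjoint P? Q? disj [] = z≤n
  length-filter-disjoint P? Q? disj (a ∷ as) with ih ← length-filter-disjoint P? Q? disj as | P? a | Q? a
  ... | yes p | yes q = contradiction q (disj p)
  ... | yes p | no  _ = s≤s ih
  ... | no  _ | yes _ = ≤-trans (≤-reflexive (+-suc _ _)) (s≤s ih)
  ... | no  _ | no  _ = m≤n⇒m≤1+n ih

module _ {A B : Set} {P : A → B → Set} (P? : ∀ a b → Dec (P a b)) where

  double-counting : ∀ as bs → sum (map (λ a → length (filter (P? a) bs)) as)
                            ≡ sum (map (λ b → length (filter (flip P? b) as)) bs)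
  double-counting [] bs = sym (zeros bs)
    where
    zeros : ∀ bs → sum (map (λ (_ : B) → 0) bs) ≡ 0
    zeros []       = refl
    zeros (_ ∷ bs) = zeros bs
  double-counting (a ∷ as) bs rewrite double-counting as bs = column bs
    where
    column : ∀ bs → length (filter (P? a) bs) + sum (map (λ b → length (filter (flip P? b) as)) bs)
                  ≡ sum (map (λ b → length (filter (flip P? b) (a ∷ as))) bs)
    column [] = refl
    column (b ∷ bs) rewrite sym (column bs) with P? a b
    ... | yes _ = cong suc (x∙yz≈y∙xz (length (filter (P? a) bs)) (length (filter (flip P? b) as)) _)
    ... | no  _ = x∙yz≈y∙xz (length (filter (P? a) bs)) (length (filter (flip P? b) as)) _

∈⇒0<length : ∀ {A : Set} {x : A} {xs} → x ∈ xs → 0 < length xs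
∈⇒0<length (here _)  = s≤s z≤n
∈⇒0<length (there _) = s≤s z≤n

-- Walks

infixr 5 _◅_

-- The vertex list is an index, so that avoidance and disjointness become statements about lists.
-- Vertices may repeat, which keeps concatenation simple; `shorten` restores paths.
data Route {V : Set} (E : V → V → Set) : V → V → List V → Set where
  stop : ∀ {u} → Route E u u (u ∷ [])
  _◅_  : ∀ {u v w l} → E u w → Route E w v l → Route E u v (u ∷ l)

module _ {V : Set} {E : V → V → Set} where

  source∈ : ∀ {u v l} → Route E u v l → u ∈ l
  source∈ stop    = here refl
  source∈ (_ ◅ _) = here refl

  target∈ : ∀ {u v l} → Route E u v l → v ∈ l
  target∈ stop    = here refl
  target∈ (_ ◅ r) = there (target∈ r)

  -- On a path the target occurs only at the end, so an initial piece containing it is the whole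
  -- path. `meet-in-S` relies on this last component, and on its mirror image in `after`.
  before : ∀ {u v w l} → Unique l → Route E u v l → w ∈ l →
           ∃ λ l′ → Route E u w l′ × l′ ⊆ l × (v ∈ l′ → v ≡ w)
  before _ stop (here refl) = _ , stop , id , λ { (here eq) → eq }
  before _ (_ ◅ _) (here refl) = _ , stop , (λ { (here eq) → here eq }) , λ { (here eq) → eq }
  before (u∉l ∷ uniq) (e ◅ r) (there w∈l) with l′ , r′ , l′⊆l , v∈l′⇒ ← before uniq r w∈l =
    _ , e ◅ r′ , (λ { (here eq) → here eq ; (there z∈) → there (l′⊆l z∈) })
      , λ { (here refl) → contradiction refl (All.lookup u∉l (target∈ r)) ; (there v∈) → v∈l′⇒ v∈ }

  after : ∀ {u v w l} → Unique l → Route E u v l → w ∈ l →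
          ∃ λ l′ → Route E w v l′ × l′ ⊆ l × Unique l′ × (u ∈ l′ → u ≡ w)
  after uniq stop (here refl) = _ , stop , id , uniq , λ _ → refl
  after uniq r@(_ ◅ _) (here refl) = _ , r , id , uniq , λ _ → refl
  after (u∉l ∷ uniq) (_ ◅ r) (there w∈l) with l′ , r′ , l′⊆l , uniq′ , _ ← after uniq r w∈l =
    l′ , r′ , there ∘ l′⊆l , uniq′ , λ u∈l′ → contradiction refl (All.lookup u∉l (l′⊆l u∈l′))

  prefix : ∀ {u v w l} → Route E u v l → w ∈ l → ∃ λ l′ → Route E u w l′ × l′ ⊆ l
  prefix stop    (here refl) = _ , stop , id
  prefix (_ ◅ _) (here refl) = _ , stop , λ { (here eq) → here eq }
  prefix (e ◅ r) (there w∈l) with l′ , r′ , l′⊆l ← prefix r w∈l =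
    _ , e ◅ r′ , λ { (here eq) → here eq ; (there z∈) → there (l′⊆l z∈) }

  suffix : ∀ {u v w l} → Route E u v l → w ∈ l → ∃ λ l′ → Route E w v l′ × l′ ⊆ l
  suffix stop      (here refl) = _ , stop , id
  suffix r@(_ ◅ _) (here refl) = _ , r , id
  suffix (_ ◅ r)   (there w∈l) with l′ , r′ , l′⊆l ← suffix r w∈l = l′ , r′ , there ∘ l′⊆l

  join : ∀ {u v w l l′} → Route E u v l → Route E v w l′ → ∃ λ l″ → Route E u w l″ × l″ ⊆ l ++ l′
  join stop r′ = _ , r′ , there
  join (e ◅ r) r′ with l″ , r″ , l″⊆ ← join r r′ =
    _ , e ◅ r″ , λ { (here eq) → here eq ; (there z∈) → there (l″⊆ z∈) }

  route-map : ∀ {E′ : V → V → Set} → (∀ {u v} → E u v → E′ u v) → ∀ {u v l} → Route E u v l → Route E′ u v l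
  route-map f stop    = stop
  route-map f (e ◅ r) = f e ◅ route-map f r

reverse-route : ∀ {V : Set} {E : V → V → Set} {u v l} → Route E u v l → ∃ λ l′ → Route (flip E) v u l′ × l′ ⊆ l
reverse-route stop = _ , stop , id
reverse-route (e ◅ r)
  with l′ , r′ , l′⊆l ← reverse-route r
  with l″ , r″ , l″⊆ ← join r′ (e ◅ stop)
  = l″ , r″ , λ z∈ → [ there ∘ l′⊆l , (λ { (here refl) → there (source∈ r) ; (there (here eq)) → here eq }) ]′
                       (∈-++⁻ l′ (l″⊆ z∈))

module _ {n : ℕ} {E : Fin n → Fin n → Set} where

  -- Loop erasure: if u recurs on the path found for the rest, everything up to that recurrence is
  -- dropped.
  shorten : ∀ {u v l} → Route E u v l → ∃ λ l′ → Route E u v l′ × l′ ⊆ l × Unique l′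
  shorten stop = _ , stop , id , [] ∷ []
  shorten {u} (e ◅ r) with l′ , r′ , l′⊆l , uniq ← shorten r | u ∈? l′
  ... | yes u∈l′ with l″ , r″ , l″⊆l′ , uniq′ , _ ← after uniq r′ u∈l′ = l″ , r″ , there ∘ l′⊆l ∘ l″⊆l′ , uniq′
  ... | no  u∉l′ = u ∷ l′ , e ◅ r′ , (λ { (here eq) → here eq ; (there z∈) → there (l′⊆l z∈) }) , ¬Any⇒All¬ _ u∉l′ ∷ uniq

-- Menger's theorem

module _ {n : ℕ} where

  private
    V = Fin n

  EdgeIn : List (V × V) → V → V → Set
  EdgeIn G u v = (u , v) ∈ G

  record Linkage (G : List (V × V)) (A B : List V) (k : ℕ) : Set where
    field
      src tgt  : Fin k → V
      verts    : Fin k → List V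
      src∈     : ∀ i → src i ∈ A
      tgt∈     : ∀ i → tgt i ∈ B
      route    : ∀ i → Route (EdgeIn G) (src i) (tgt i) (verts i)
      uniq     : ∀ i → Unique (verts i)
      disjoint : ∀ {i j w} → w ∈ verts i → w ∈ verts j → i ≡ j

    src-injective : Injective _≡_ _≡_ src
    src-injective {i} {j} eq = disjoint (source∈ (route i)) (subst (_∈ verts j) (sym eq) (source∈ (route j)))

    tgt-injective : Injective _≡_ _≡_ tgt
    tgt-injective {i} {j} eq = disjoint (target∈ (route i)) (subst (_∈ verts j) (sym eq) (target∈ (route j)))

  Separates : List (V × V) → (A B S : List V) → Set
  Separates G A B S = ∀ {u v l} → u ∈ A → v ∈ B → Route (EdgeIn G) u v l → ∃ λ s → s ∈ l × s ∈ S

  until-first-use : ∀ {x y G u v l} → Route (EdgeIn ((x , y) ∷ G)) u v l →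
                    Route (EdgeIn G) u v l ⊎ ∃ λ l′ → Route (EdgeIn G) u x l′ × l′ ⊆ l
  until-first-use stop = inj₁ stop
  until-first-use (here refl ◅ r) = inj₂ (_ , stop , λ { (here eq) → here eq })
  until-first-use (there e ◅ r) with until-first-use r
  ... | inj₁ r′ = inj₁ (e ◅ r′)
  ... | inj₂ (_ , r′ , l′⊆l) = inj₂ (_ , e ◅ r′ , λ { (here eq) → here eq ; (there z∈) → there (l′⊆l z∈) })

  since-last-use : ∀ {x y G u v l} → Route (EdgeIn ((x , y) ∷ G)) u v l →
                   Route (EdgeIn G) u v l ⊎ ∃ λ l′ → Route (EdgeIn G) y v l′ × l′ ⊆ l
  since-last-use stop = inj₁ stop
  since-last-use (e ◅ r) with since-last-use r
  ... | inj₂ (_ , r′ , l′⊆l) = inj₂ (_ , r′ , there ∘ l′⊆l)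
  since-last-use (here refl ◅ r) | inj₁ r′ = inj₂ (_ , r′ , there)
  since-last-use (there e ◅ r)   | inj₁ r′ = inj₁ (e ◅ r′)

  module _ {x y : V} {G : List (V × V)} {A B S : List V} (sep : Separates G A B S) where

    -- A route from A to B either reaches x before it first uses the new arc, or stays in G and
    -- meets S. In both cases an initial piece is a route of G from A to `x ∷ S`, and T meets it.
    separates-∷ˡ : ∀ {T} → Separates G A (x ∷ S) T → Separates ((x , y) ∷ G) A B T
    separates-∷ˡ sepT u∈A v∈B r with until-first-use r
    ... | inj₂ (l′ , r′ , l′⊆l) with t , t∈ , t∈T ← sepT u∈A (here refl) r′ = t , l′⊆l t∈ , t∈T
    ... | inj₁ r′
      with s , s∈l , s∈S ← sep u∈A v∈B r′
      with l″ , r″ , l″⊆l ← prefix r′ s∈l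
      with t , t∈ , t∈T ← sepT u∈A (there s∈S) r″ = t , l″⊆l t∈ , t∈T

    separates-∷ʳ : ∀ {T} → Separates G (y ∷ S) B T → Separates ((x , y) ∷ G) A B T
    separates-∷ʳ sepT u∈A v∈B r with since-last-use r
    ... | inj₂ (l′ , r′ , l′⊆l) with t , t∈ , t∈T ← sepT (here refl) v∈B r′ = t , l′⊆l t∈ , t∈T
    ... | inj₁ r′
      with s , s∈l , s∈S ← sep u∈A v∈B r′
      with l″ , r″ , l″⊆l ← suffix r′ s∈l
      with t , t∈ , t∈T ← sepT (there s∈S) v∈B r″ = t , l″⊆l t∈ , t∈T

    separates-source : x ∈ S → Separates ((x , y) ∷ G) A B S
    separates-source x∈S u∈A v∈B r with until-first-use r
    ... | inj₁ r′ = sep u∈A v∈B r′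
    ... | inj₂ (_ , r′ , l′⊆l) = x , l′⊆l (target∈ r′) , x∈S

    separates-target : y ∈ S → Separates ((x , y) ∷ G) A B S
    separates-target y∈S u∈A v∈B r with since-last-use r
    ... | inj₁ r′ = sep u∈A v∈B r′
    ... | inj₂ (_ , r′ , l′⊆l) = y , l′⊆l (source∈ r′) , y∈S

    module Splice {k : ℕ} (S<k : length S < k) (x∉S : x ∉ S) (y∉S : y ∉ S)
                  (L : Linkage G A (x ∷ S) k) (M : Linkage G (y ∷ S) B k) where
      module L = Linkage L
      module M = Linkage M

      -- As `length S < k`, the k path ends exhaust `x ∷ S`. So every vertex of S is the end of some
      -- path and, by disjointness, lies on no other.
      ∈S⇒tgt : ∀ {i w} → w ∈ L.verts i → w ∈ S → w ≡ L.tgt i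
      ∈S⇒tgt {i} w∈ w∈S with j , refl ← injective⇒covers L.tgt-injective L.tgt∈ S<k (there w∈S) =
        cong L.tgt (L.disjoint (target∈ (L.route j)) w∈)

      ∈S⇒src : ∀ {i w} → w ∈ M.verts i → w ∈ S → w ≡ M.src i
      ∈S⇒src {i} w∈ w∈S with j , refl ← injective⇒covers M.src-injective M.src∈ S<k (there w∈S) =
        cong M.src (M.disjoint (source∈ (M.route j)) w∈)

      -- Following the first path to w and the second one from w gives a route of G from A to B,
      -- which must meet S. The first path meets S only at its end and the second only at its start,
      -- so the vertex found is w itself.
      meet-in-S : ∀ {i j w} → w ∈ L.verts i → w ∈ M.verts j → w ∈ S
      meet-in-S {i} {j} {w} w∈L w∈M
        with lp , p , lp⊆ , end ← before (L.uniq i) (L.route i) w∈L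
        with lq , q , lq⊆ , _ , start ← after (M.uniq j) (M.route j) w∈M
        with lr , r , lr⊆ ← join p q
        with s , s∈ , s∈S ← sep (L.src∈ i) (M.tgt∈ j) r
        with ∈-++⁻ lp (lr⊆ s∈)
      ... | inj₁ s∈lp with refl ← ∈S⇒tgt (lp⊆ s∈lp) s∈S = subst (_∈ S) (end s∈lp) s∈S
      ... | inj₂ s∈lq with refl ← ∈S⇒src (lq⊆ s∈lq) s∈S = subst (_∈ S) (start s∈lq) s∈S

      Continues : Fin k → Fin k → Set
      Continues i j = (L.tgt i ≡ x × M.src j ≡ y) ⊎ (L.tgt i ∈ S × L.tgt i ≡ M.src j)

      continuation : ∀ i → ∃ (Continues i)
      continuation i with L.tgt∈ i
      ... | here eq = let j , eq′ = injective⇒covers M.src-injective M.src∈ S<k (here refl) in j , inj₁ (eq , eq′)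
      ... | there t∈S = let j , eq = injective⇒covers M.src-injective M.src∈ S<k (there t∈S) in j , inj₂ (t∈S , sym eq)

      next : Fin k → Fin k
      next i = proj₁ (continuation i)

      next-injective : Injective _≡_ _≡_ next
      next-injective {i} {i′} eq with continuation i | continuation i′
      next-injective refl | _ , inj₁ (p , _) | _ , inj₁ (q , _) = L.tgt-injective (trans p (sym q))
      next-injective refl | _ , inj₂ (_ , p) | _ , inj₂ (_ , q) = L.tgt-injective (trans p (sym q))
      next-injective refl | _ , inj₁ (_ , p) | _ , inj₂ (t∈S , q) = contradiction (subst (_∈ S) (trans q p) t∈S) y∉S
      next-injective refl | _ , inj₂ (t∈S , q) | _ , inj₁ (_ , p) = contradiction (subst (_∈ S) (trans q p) t∈S) y∉S

      -- The common vertex lies in S, so it is the end of one path and the start of the other. Hence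
      -- the two paths belong to the same spliced path, and different spliced paths stay disjoint.
      meet⇒next : ∀ {i j w} → w ∈ L.verts i → w ∈ M.verts j → next i ≡ j
      meet⇒next {i} {j} w∈L w∈M with continuation i
      ... | j′ , inj₁ (eq , _) = contradiction (subst (_∈ S) (trans (∈S⇒tgt w∈L w∈S) eq) w∈S) x∉S
        where w∈S = meet-in-S w∈L w∈M
      ... | j′ , inj₂ (_ , eq) = M.src-injective (trans (sym eq) (trans (sym (∈S⇒tgt w∈L w∈S)) (∈S⇒src w∈M w∈S)))
        where w∈S = meet-in-S w∈L w∈M

      spliced : ∀ i → ∃ λ l → Route (EdgeIn ((x , y) ∷ G)) (L.src i) (M.tgt (next i)) l
                            × l ⊆ L.verts i ++ M.verts (next i) × Unique l
      spliced i with continuation i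
      ... | j , inj₁ (eq , eq′)
        with l , r , l⊆ ← join (route-map there (L.route i)) (subst₂ (EdgeIn ((x , y) ∷ G)) (sym eq) (sym eq′) (here refl) ◅ route-map there (M.route j))
        with l′ , r′ , l′⊆ , u ← shorten r
        = l′ , r′ , (λ z∈ → [ ∈-++⁺ˡ , (λ { (here refl) → ∈-++⁺ˡ (target∈ (L.route i)) ; (there z∈) → ∈-++⁺ʳ (L.verts i) z∈ }) ]′ (∈-++⁻ (L.verts i) (l⊆ (l′⊆ z∈)))) , u
      ... | j , inj₂ (_ , eq)
        with l , r , l⊆ ← join (route-map there (L.route i)) (subst (λ s → Route (EdgeIn ((x , y) ∷ G)) s (M.tgt j) (M.verts j)) (sym eq) (route-map there (M.route j)))
        with l′ , r′ , l′⊆ , u ← shorten r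
        = l′ , r′ , l⊆ ∘ l′⊆ , u

      splice : Linkage ((x , y) ∷ G) A B k
      splice = record
        { src = L.src ; tgt = M.tgt ∘ next ; verts = proj₁ ∘ spliced
        ; src∈ = L.src∈ ; tgt∈ = M.tgt∈ ∘ next
        ; route = proj₁ ∘ proj₂ ∘ spliced
        ; uniq = proj₂ ∘ proj₂ ∘ proj₂ ∘ spliced
        ; disjoint = λ {i} {j} w∈i w∈j → disj (split i w∈i) (split j w∈j)
        }
        where
        split : ∀ i {w} → w ∈ proj₁ (spliced i) → w ∈ L.verts i ⊎ w ∈ M.verts (next i)
        split i w∈ = ∈-++⁻ (L.verts i) (proj₁ (proj₂ (proj₂ (spliced i))) w∈)
        disj : ∀ {i j w} → w ∈ L.verts i ⊎ w ∈ M.verts (next i) → w ∈ L.verts j ⊎ w ∈ M.verts (next j) → i ≡ j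
        disj (inj₁ p) (inj₁ q) = L.disjoint p q
        disj (inj₁ p) (inj₂ q) = next-injective (meet⇒next p q)
        disj (inj₂ p) (inj₁ q) = sym (next-injective (meet⇒next q p))
        disj (inj₂ p) (inj₂ q) = next-injective (M.disjoint p q)

  module _ (A B : List V) where

    -- Without arcs every route is a single vertex, so the intersection of A and B serves both as
    -- separator and as a set of trivial paths. Duplicates are removed because its length is
    -- compared with k.
    common : List V
    common = deduplicate _≟_ (filter (_∈? B) A)

    common-separates : Separates [] A B common
    common-separates u∈A v∈B stop = _ , here refl , ∈-deduplicate⁺ _≟_ (∈-filter⁺ (_∈? B) u∈A v∈B)

    common-links : ∀ {k} → k ≤ length common → Linkage [] A B k
    common-links {k} k≤ = record
      { src = point ; tgt = point ; verts = λ i → point i ∷ []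
      ; src∈ = proj₁ ∘ point∈ ; tgt∈ = proj₂ ∘ point∈
      ; route = λ _ → stop ; uniq = λ _ → [] ∷ []
      ; disjoint = λ { (here refl) (here eq) →
          inject≤-injective k≤ k≤ _ _ (unique⇒lookup-injective {xs = common} (deduplicate-! _≟_ _) eq) } }
      where
      point : Fin k → V
      point i = lookup common (inject≤ i k≤)
      point∈ : ∀ i → point i ∈ A × point i ∈ B
      point∈ i = ∈-filter⁻ (_∈? B) (∈-deduplicate⁻ _≟_ (filter (_∈? B) A) (∈-lookup {xs = common} (inject≤ i k≤)))

  -- Göring's induction on the arcs: a small separator S of the graph without x → y becomes
  -- a separator or yields two linkages, into x ∷ S and out of y ∷ S, which meet only in S.
  menger : ∀ G A B k → (∃ λ S → length S < k × Separates G A B S) ⊎ Linkage G A B k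
  menger [] A B k with k ≤? length (common A B)
  ... | no  k≰ = inj₁ (common A B , ≰⇒> k≰ , common-separates A B)
  ... | yes k≤ = inj₂ (common-links A B k≤)
  menger ((x , y) ∷ G) A B k with menger G A B k
  ... | inj₂ L = inj₂ (record
    { src = L.src ; tgt = L.tgt ; verts = L.verts ; src∈ = L.src∈ ; tgt∈ = L.tgt∈
    ; route = λ i → route-map there (L.route i) ; uniq = L.uniq ; disjoint = L.disjoint })
    where module L = Linkage L
  ... | inj₁ (S , S<k , sep) with x ∈? S | y ∈? S
  ...   | yes x∈S | _ = inj₁ (S , S<k , separates-source sep x∈S)
  ...   | no _ | yes y∈S = inj₁ (S , S<k , separates-target sep y∈S)
  ...   | no x∉S | no y∉S with menger G A (x ∷ S) k | menger G (y ∷ S) B k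
  ...     | inj₁ (T , T<k , sepT) | _ = inj₁ (T , T<k , separates-∷ˡ sep sepT)
  ...     | inj₂ _ | inj₁ (T , T<k , sepT) = inj₁ (T , T<k , separates-∷ʳ sep sepT)
  ...     | inj₂ L | inj₂ M = inj₂ (Splice.splice sep S<k x∉S y∉S L M)

-- Funnels in tournaments

-- block (inj₁ i) holds the two vertices reserved for leaving x i; block (inj₂ j) the feeders of sink j.
record Approach {n k : ℕ} (R : Fin n → Fin n → Set) (m : ℕ) (x : Fin k → Fin n) (F₀ : List (Fin n)) : Set where
  field
    sink           : Fin m → Fin n
    block          : Fin k ⊎ Fin m → List (Fin n)
    bad            : Fin k → List (Fin m)
    bad≤           : ∀ i → length (bad i) ≤ k
    approach       : ∀ i {j} → j ∉ bad i → ∃ λ l → Route R (x i) (sink j) l ×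
                       l ⊆ x i ∷ sink j ∷ block (inj₁ i) ++ block (inj₂ j)
    sink-injective : Injective _≡_ _≡_ sink
    sink∉F₀        : ∀ j → sink j ∉ F₀
    block∉F₀       : ∀ t {v} → v ∈ block t → v ∉ F₀
    sink∉block     : ∀ j t → sink j ∉ block t
    block-disjoint : ∀ {s t v} → v ∈ block s → v ∈ block t → s ≡ t
    block≤2        : ∀ t → length (block t) ≤ 2

-- Stated for a bare relation, so that the reversed tournament is another instance and the dual
-- construction needs no second proof.
module Tournament {n : ℕ} (R : Fin n → Fin n → Set) (R? : ∀ u v → Dec (R u v))
  (asym : ∀ {u v} → R u v → ¬ R v u) (total : ∀ {u v} → u ≢ v → R u v ⊎ R v u) where

  private
    V = Fin n

  out : V → List V
  out v = filter (R? v) (allFin n)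

  outWithin inWithin : List V → V → ℕ
  outWithin O w = length (filter (R? w) O)
  inWithin  O w = length (filter (flip R? w) O)

  -- Within O the out-degrees and the in-degrees have the same sum, and asymmetry makes the two
  -- neighbourhoods of each vertex disjoint.
  degree-sum : ∀ O → sum (map (λ w → outWithin O w + outWithin O w) O) ≤ length O * length O
  degree-sum O = begin
    sum (map (λ w → outWithin O w + outWithin O w) O)      ≡⟨ sum-map-+ (outWithin O) (outWithin O) O ⟩
    sum (map (outWithin O) O) + sum (map (outWithin O) O)  ≡⟨ cong (sum (map (outWithin O) O) +_) (double-counting R? O O) ⟩
    sum (map (outWithin O) O) + sum (map (inWithin O) O)   ≡⟨ sum-map-+ (outWithin O) (inWithin O) O ⟨
    sum (map (λ w → outWithin O w + inWithin O w) O)       ≡⟨ *-identityˡ _ ⟨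
    1 * sum (map (λ w → outWithin O w + inWithin O w) O)   ≤⟨ sum-≤ 1 (length O) _ O (λ {w} _ →
                                                                ≤-trans (≤-reflexive (*-identityˡ _))
                                                                        (length-filter-disjoint (R? w) (flip R? w) asym O)) ⟩
    length O * length O                                    ∎
    where open ≤-Reasoning

  ∃-halving : ∀ O → 0 < length O → ∃ λ w → w ∈ O × 2 * outWithin O w ≤ length O
  ∃-halving O 0<O with w , w∈O , ≤O ← ∃-≤-average (length O) (λ w → outWithin O w + outWithin O w) O 0<O (degree-sum O)
    = w , w∈O , ≤-trans (≤-reflexive (cong (outWithin O w +_) (+-identityʳ (outWithin O w)))) ≤O

  -- Every vertex outside F and the exceptional set O can walk to the sink through the feeders.
  record Funnel (F : List V) (c : ℕ) (O : List V) : Set where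
    field
      sink       : V
      feeders    : List V
      feeders≤   : length feeders ≤ c

    members : List V
    members = sink ∷ feeders

    field
      members∉F  : ∀ {v} → v ∈ members → v ∉ F
      sink∉      : sink ∉ feeders
      beyond     : ∀ {o v} → o ∈ O → v ∈ members → R v o
      O∉F        : ∀ {o} → o ∈ O → o ∉ F
      inflow     : ∀ {z} → z ∉ F → z ∉ members → z ∉ O → ∃ λ l → Route R z sink l × l ⊆ z ∷ members

  module _ {F : List V} where

    seed : ∀ v → v ∉ F → Funnel F 0 (filter (_∉? F) (out v))
    seed v v∉F = record
      { sink = v ; feeders = [] ; feeders≤ = z≤n
      ; members∉F = λ { (here refl) → v∉F }
      ; sink∉ = λ ()
      ; beyond = λ { o∈ (here refl) → proj₂ (∈-filter⁻ (R? v) {xs = allFin n} (proj₁ (∈-filter⁻ (_∉? F) o∈))) }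
      ; O∉F = λ {o} o∈ → proj₂ (∈-filter⁻ (_∉? F) {v = o} {xs = out v} o∈)
      ; inflow = λ z∉F z∉v z∉O → case total (z∉v ∘ here) of λ
          { (inj₁ z→v) → _ , z→v ◅ stop , λ {_} v∈ → v∈
          ; (inj₂ v→z) → contradiction (∈-filter⁺ (_∉? F) (∈-filter⁺ (R? v) (∈-allFin _) v→z) z∉F) z∉O } }

    -- By `beyond` the old sink beats w, so whatever reached the old sink goes on to w. A vertex of
    -- O other than w that leaves the exceptional set is not beaten by w, hence beats it.
    extend : ∀ {c O w} → Funnel F c O → w ∈ O → Funnel F (suc c) (filter (R? w) O)
    extend {c} {O} {w} fn w∈O = record
      { sink = w ; feeders = members ; feeders≤ = s≤s feeders≤
      ; members∉F = λ { (here refl) → O∉F w∈O ; (there v∈) → members∉F v∈ }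
      ; sink∉ = λ w∈ → asym (beyond w∈O w∈) (beyond w∈O w∈)
      ; beyond = λ { o∈ (here refl) → proj₂ (∈-filter⁻ (R? w) {xs = O} o∈)
                   ; o∈ (there v∈)  → beyond (proj₁ (∈-filter⁻ (R? w) o∈)) v∈ }
      ; O∉F = O∉F ∘ proj₁ ∘ ∈-filter⁻ (R? w)
      ; inflow = flow }
      where
      open Funnel fn
      flow : ∀ {z} → z ∉ F → z ∉ w ∷ members → z ∉ filter (R? w) O → ∃ λ l → Route R z w l × l ⊆ z ∷ w ∷ members
      flow {z} z∉F z∉ z∉O′ with z ∈? O
      ... | yes z∈O with total (z∉ ∘ here)
      ...   | inj₁ z→w = _ , z→w ◅ stop , λ { (here eq) → here eq ; (there (here eq)) → there (here eq) }
      ...   | inj₂ w→z = contradiction (∈-filter⁺ (R? w) z∈O w→z) z∉O′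
      flow {z} z∉F z∉ z∉O′ | no z∉O
        with l , r , l⊆ ← inflow z∉F (z∉ ∘ there) z∉O
        with l′ , r′ , l′⊆ ← join r (beyond w∈O (here refl) ◅ stop)
        = l′ , r′ , λ v∈ → [ (λ v∈l → case l⊆ v∈l of λ { (here eq) → here eq ; (there m) → there (there m) })
                           , (λ { (here eq) → there (there (here eq)) ; (there (here eq)) → there (here eq) }) ]′ (∈-++⁻ l (l′⊆ v∈))

    halve : ∀ {c O} → Funnel F c O → ∃ λ O′ → Funnel F (suc c) O′ × 2 * length O′ ≤ length O
    -- With no exceptional vertex there is no new sink to take and the funnel is kept; this is why
    -- the feeders are bounded by c and not counted exactly.
    halve {O = []} fn = [] , record
      { Funnel fn ; feeders≤ = m≤n⇒m≤1+n (Funnel.feeders≤ fn) } , z≤n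
    halve {O = O@(_ ∷ _)} fn with w , w∈O , half ← ∃-halving O (s≤s z≤n) = _ , extend fn w∈O , half

  -- `E≤` compares with the full out-degree of any vertex outside F, although v is minimal for the
  -- out-degree outside F: the later averaging runs over all out-neighbours.
  record GoodFunnel (F : List V) : Set where
    field
      {E}     : List V
      funnel₂ : Funnel F 2 E
      E≤      : ∀ {x} → x ∉ F → 4 * length E ≤ length (out x)
    open Funnel funnel₂ public

  module _ (F : List V) (v₀ : V) (v₀∉F : v₀ ∉ F) where

    private
      outside : V → ℕ
      outside x = length (filter (_∉? F) (out x))

      candidates : List V
      candidates = filter (_∉? F) (allFin n)

      v : V
      -- `v₀` is the default value of `argmin`; being outside F itself, it guarantees that the
      -- minimiser is too.
      v = argmin outside v₀ candidates

      v∉F : v ∉ F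
      v∉F = argmin-all outside {P = _∉ F} v₀∉F (all-filter (_∉? F) (allFin n))

      outside-v≤ : ∀ {x} → x ∉ F → outside v ≤ length (out x)
      outside-v≤ {x} x∉F = ≤-trans
        (All.lookup (f[argmin]≤f[xs] {f = outside} v₀ candidates) (∈-filter⁺ (_∉? F) (∈-allFin x) x∉F))
        (length-filter (_∉? F) (out x))

    funnel : GoodFunnel F
    funnel =
      let O₁ , fn₁ , O₁≤ = halve (seed v v∉F)
          O₂ , fn₂ , O₂≤ = halve fn₁
      in record { E = O₂ ; funnel₂ = fn₂ ; E≤ = λ x∉F → begin
        4 * length O₂        ≡⟨ *-assoc 2 2 (length O₂) ⟩
        2 * (2 * length O₂)  ≤⟨ *-monoʳ-≤ 2 O₂≤ ⟩
        2 * length O₁        ≤⟨ O₁≤ ⟩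
        outside v            ≤⟨ outside-v≤ x∉F ⟩
        length (out _)       ∎ }
      where open ≤-Reasoning

  -- Families of disjoint funnels

  open GoodFunnel

  -- The funnels are chosen one after another, so each has its own forbidden list. By `F⊆` a vertex
  -- outside `F₀` and all members is outside every such list, and the inflow of each funnel can
  -- apply to it.
  record Funnels (m : ℕ) (F₀ : List V) : Set where
    field
      F        : Fin m → List V
      fn       : ∀ j → GoodFunnel (F j)
      F₀⊆F     : ∀ j → F₀ ⊆ F j
      disjoint : ∀ {i j v} → v ∈ members (fn i) → v ∈ members (fn j) → i ≡ j
      F⊆       : ∀ {j v} → v ∈ F j → v ∈ F₀ ⊎ ∃ λ i → v ∈ members (fn i)

  funnels-∷ : ∀ {m F₀} (g : GoodFunnel F₀) → Funnels m (members g ++ F₀) → Funnels (suc m) F₀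
  funnels-∷ {m} {F₀} g fs = record
    { F = F′ ; fn = fn′ ; F₀⊆F = F₀⊆F′ ; disjoint = λ {i} {j} → disjoint′ {i} {j} ; F⊆ = λ {j} → F⊆′ {j} }
    where
    open Funnels fs
    F′ : Fin (suc m) → List V
    F′ zero    = F₀
    F′ (suc j) = F j
    fn′ : ∀ j → GoodFunnel (F′ j)
    fn′ zero    = g
    fn′ (suc j) = fn j
    F₀⊆F′ : ∀ j → F₀ ⊆ F′ j
    F₀⊆F′ zero    = id
    F₀⊆F′ (suc j) = F₀⊆F j ∘ ∈-++⁺ʳ (members g)
    new : ∀ {j v} → v ∈ members g → v ∉ members (fn j)
    new {j} v∈g v∈j = members∉F (fn j) v∈j (F₀⊆F j (∈-++⁺ˡ v∈g))
    disjoint′ : ∀ {i j v} → v ∈ members (fn′ i) → v ∈ members (fn′ j) → i ≡ j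
    disjoint′ {zero}  {zero}  _ _ = refl
    disjoint′ {zero}  {suc j} p q = contradiction q (new p)
    disjoint′ {suc i} {zero}  p q = contradiction p (new q)
    disjoint′ {suc i} {suc j} p q = cong suc (disjoint p q)
    F⊆′ : ∀ {j v} → v ∈ F′ j → v ∈ F₀ ⊎ ∃ λ i → v ∈ members (fn′ i)
    F⊆′ {zero}  v∈ = inj₁ v∈
    F⊆′ {suc j} v∈ with F⊆ v∈
    ... | inj₂ (i , v∈i) = inj₂ (suc i , v∈i)
    ... | inj₁ v∈′ = [ (λ v∈g → inj₂ (zero , v∈g)) , inj₁ ]′ (∈-++⁻ (members g) v∈′)

  members++-length : ∀ m {F₀} (g : GoodFunnel F₀) → m * 3 + length (members g ++ F₀) ≤ suc m * 3 + length F₀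
  members++-length m {F₀} g = begin
    m * 3 + length (members g ++ F₀)           ≡⟨ cong (m * 3 +_) (length-++ (members g)) ⟩
    m * 3 + (length (members g) + length F₀)   ≤⟨ +-monoʳ-≤ (m * 3) (+-monoˡ-≤ (length F₀) (s≤s (feeders≤ g))) ⟩
    m * 3 + (3 + length F₀)                    ≡⟨ +-assoc (m * 3) 3 (length F₀) ⟨
    m * 3 + 3 + length F₀                      ≡⟨ cong (_+ length F₀) (+-comm (m * 3) 3) ⟩
    suc m * 3 + length F₀                      ∎
    where open ≤-Reasoning

  funnels : ∀ B m F₀ → (∀ F → length F ≤ B → ∃ λ (v : V) → v ∉ F) → m * 3 + length F₀ ≤ B → Funnels m F₀
  funnels B zero    F₀ fresh F₀≤ = record
    { F = λ () ; fn = λ () ; F₀⊆F = λ () ; disjoint = λ { {()} } ; F⊆ = λ { {()} } }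
  funnels B (suc m) F₀ fresh F₀≤ =
    let v₀ , v₀∉ = fresh F₀ (m+n≤o⇒n≤o (suc m * 3) F₀≤)
        g        = funnel F₀ v₀ v₀∉
    in funnels-∷ g (funnels B m (members g ++ F₀) fresh (≤-trans (members++-length m g) F₀≤))

  -- Routes from prescribed vertices to the sinks

  module _ (K B k : ℕ)
    (escape : ∀ x F → length F < K → ∃ λ v → R x v × v ∉ F)
    (4B≤K : 4 * B ≤ K) (B<K : B < K) where

    private
      m : ℕ
      m = 3 * k

      -- If `out x` had fewer than K entries, escaping from `out x` itself would give an
      -- out-neighbour outside it.
      K≤out : ∀ x → K ≤ length (out x)
      K≤out x with K ≤? length (out x)
      ... | yes K≤ = K≤
      ... | no  K≰ = let v , x→v , v∉ = escape x (out x) (≰⇒> K≰)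
                     in contradiction (∈-filter⁺ (R? x) (∈-allFin v) x→v) v∉

    module _ {F₀ : List V} (fs : Funnels m F₀) where

      open Funnels fs

      taken : List V
      taken = concat (tabulate (λ j → members (fn j))) ++ F₀

      member-taken : ∀ j {v} → v ∈ members (fn j) → v ∈ taken
      member-taken j v∈ = ∈-++⁺ˡ (∈-concat-tabulate _ j v∈)

      F⊆taken : ∀ j → F j ⊆ taken
      F⊆taken j v∈ = [ ∈-++⁺ʳ _ , (λ (i , v∈i) → member-taken i v∈i) ]′ (F⊆ {j} v∈)

      taken≤ : length taken ≤ m * 3 + length F₀
      taken≤ = ≤-trans (≤-reflexive (length-++ (concat (tabulate (λ j → members (fn j))))))
                       (+-monoˡ-≤ _ (length-concat-tabulate m _ (λ j → s≤s (feeders≤ (fn j)))))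

      exceptions : V → List (Fin m)
      exceptions z = filter (λ j → z ∈? E (fn j)) (allFin m)

      module _ {x̂ : V} (x̂∉taken : x̂ ∉ taken) {L : List V} (L≤B : length L ≤ B) where

        available : List V
        available = filter (_∉? L) (out x̂)

        out≤ : length (out x̂) ≤ length L + length available
        out≤ = ≤-trans (unique-⊆⇒length≤ (Unique.filter⁺ (R? x̂) (Unique.allFin⁺ n)) covered)
                       (≤-reflexive (length-++ L))
          where
          covered : out x̂ ⊆ L ++ available
          covered {v} v∈ with v ∈? L
          ... | yes v∈L = ∈-++⁺ˡ v∈L
          ... | no  v∉L = ∈-++⁺ʳ L (∈-filter⁺ (_∉? L) v∈ v∉L)

        -- Both E and L have at most a quarter as many entries as `out x̂`, so at least three
        -- quarters of the out-neighbours are available. The common summand o avoids subtraction.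
        3E≤available : ∀ j → 3 * length (E (fn j)) ≤ length available
        3E≤available j = *-cancelˡ-≤ 4 (+-cancelˡ-≤ (length (out x̂)) _ _ (begin
          o + 4 * (3 * e)     ≡⟨ cong (o +_) (trans (sym (*-assoc 4 3 e)) (*-assoc 3 4 e)) ⟩
          o + 3 * (4 * e)     ≤⟨ +-monoʳ-≤ o (*-monoʳ-≤ 3 (E≤ (fn j) (x̂∉taken ∘ F⊆taken j))) ⟩
          4 * o               ≤⟨ *-monoʳ-≤ 4 out≤ ⟩
          4 * (length L + a)  ≡⟨ *-distribˡ-+ 4 (length L) a ⟩
          4 * length L + 4 * a ≤⟨ +-monoˡ-≤ (4 * a) (≤-trans (*-monoʳ-≤ 4 L≤B) (≤-trans 4B≤K (K≤out x̂))) ⟩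
          o + 4 * a           ∎))
          where
          open ≤-Reasoning
          o = length (out x̂)
          a = length available
          e = length (E (fn j))

        -- Pairs of an available z and a funnel with z exceptional are counted by funnel: 3k
        -- funnels, each with at most a third of the available vertices.
        exception-sum : sum (map (λ z → length (exceptions z)) available) ≤ length available * k
        exception-sum = *-cancelˡ-≤ 3 (begin
          3 * sum (map (λ z → length (exceptions z)) available)
            ≡⟨ cong (3 *_) (double-counting (λ z j → z ∈? E (fn j)) available (allFin m)) ⟩
          3 * sum (map (λ j → length (filter (λ z → z ∈? E (fn j)) available)) (allFin m))
            ≤⟨ sum-≤ 3 (length available) _ (allFin m) (λ {j} _ →
                 ≤-trans (*-monoʳ-≤ 3 (column≤ j)) (3E≤available j)) ⟩
          length (allFin m) * length available
            ≡⟨ cong (_* length available) (length-tabulate {n = m} id) ⟩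
          3 * k * length available
            ≡⟨ trans (*-assoc 3 k _) (cong (3 *_) (*-comm k _)) ⟩
          3 * (length available * k) ∎)
          where
          open ≤-Reasoning
          column≤ : ∀ j → length (filter (λ z → z ∈? E (fn j)) available) ≤ length (E (fn j))
          column≤ j = unique-⊆⇒length≤
            (Unique.filter⁺ (λ z → z ∈? E (fn j)) (Unique.filter⁺ (_∉? L) (Unique.filter⁺ (R? x̂) (Unique.allFin⁺ n))))
            (λ z∈ → proj₂ (∈-filter⁻ (λ z → z ∈? E (fn j)) {xs = available} z∈))

        good-exit : ∃ λ z → (R x̂ z × length (exceptions z) ≤ k) × z ∉ L
        good-exit =
          -- Averaging needs a non-empty list, and this v is available.
          let v , x̂→v , v∉L = escape x̂ L (≤-<-trans L≤B B<K)
              z , z∈ , few = ∃-≤-average k (length ∘ exceptions) available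
                (∈⇒0<length (∈-filter⁺ (_∉? L) (∈-filter⁺ (R? x̂) (∈-allFin v) x̂→v) v∉L)) exception-sum
              z∈out , z∉L = ∈-filter⁻ (_∉? L) {xs = out x̂} z∈
          in z , (proj₂ (∈-filter⁻ (R? x̂) {xs = allFin n} z∈out) , few) , z∉L

      module _ {x x̂ z : Fin k → V}
        (x→x̂ : ∀ i → R (x i) (x̂ i)) (x̂-inj : Injective _≡_ _≡_ x̂) (x̂∉taken : ∀ i → x̂ i ∉ taken)
        (good : ∀ i → R (x̂ i) (z i) × length (exceptions (z i)) ≤ k)
        (z-inj : Injective _≡_ _≡_ z) (z∉ : ∀ i → z i ∉ tabulate x̂ ++ taken) where

        block : Fin k ⊎ Fin m → List V
        block (inj₁ i) = x̂ i ∷ z i ∷ []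
        block (inj₂ j) = feeders (fn j)

        lead∉taken : ∀ i {v} → v ∈ block (inj₁ i) → v ∉ taken
        lead∉taken i (here refl)         = x̂∉taken i
        lead∉taken i (there (here refl)) = z∉ i ∘ ∈-++⁺ʳ (tabulate x̂)

        x̂≢z : ∀ i j → x̂ i ≢ z j
        x̂≢z i j eq = z∉ j (∈-++⁺ˡ (subst (_∈ tabulate x̂) eq (∈-tabulate⁺ i)))

        block-disjoint : ∀ {s t v} → v ∈ block s → v ∈ block t → s ≡ t
        block-disjoint {inj₁ i} {inj₁ j} (here refl) (here eq)                 = cong inj₁ (x̂-inj eq)
        block-disjoint {inj₁ i} {inj₁ j} (here refl) (there (here eq))         = contradiction eq (x̂≢z i j)
        block-disjoint {inj₁ i} {inj₁ j} (there (here refl)) (here eq)         = contradiction (sym eq) (x̂≢z j i)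
        block-disjoint {inj₁ i} {inj₁ j} (there (here refl)) (there (here eq)) = cong inj₁ (z-inj eq)
        block-disjoint {inj₁ i} {inj₂ j} p q = contradiction (member-taken j (there q)) (lead∉taken i p)
        block-disjoint {inj₂ i} {inj₁ j} p q = contradiction (member-taken i (there p)) (lead∉taken j q)
        block-disjoint {inj₂ i} {inj₂ j} p q = cong inj₂ (disjoint (there p) (there q))

        approach : ∀ i {j} → j ∉ exceptions (z i) → ∃ λ l → Route R (x i) (sink (fn j)) l ×
                     l ⊆ x i ∷ sink (fn j) ∷ block (inj₁ i) ++ block (inj₂ j)
        approach i {j} j∉
          with l , r , l⊆ ← inflow (fn j) (lead∉taken i (there (here refl)) ∘ F⊆taken j)
                              (lead∉taken i (there (here refl)) ∘ member-taken j)
                              (j∉ ∘ ∈-filter⁺ (λ j → z i ∈? E (fn j)) (∈-allFin j))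
          = _ , x→x̂ i ◅ proj₁ (good i) ◅ r , λ
          { (here eq) → here eq
          ; (there (here eq)) → there (there (here eq))
          ; (there (there v∈)) → case l⊆ v∈ of λ
              { (here eq) → there (there (there (here eq)))
              ; (there (here eq)) → there (here eq)
              ; (there (there v∈f)) → there (there (there (there v∈f))) } }

        assemble : Approach R m x F₀
        assemble = record
          { sink = λ j → sink (fn j)
          ; block = block
          ; bad = exceptions ∘ z
          ; bad≤ = proj₂ ∘ good
          ; approach = approach
          ; sink-injective = λ {i} {j} eq → disjoint {i} {j} (here refl) (here eq)
          ; sink∉F₀ = λ j s∈ → members∉F (fn j) (here refl) (F₀⊆F j s∈)
          ; block∉F₀ = λ { (inj₁ i) v∈ v∈F₀ → lead∉taken i v∈ (∈-++⁺ʳ _ v∈F₀)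
                         ; (inj₂ j) v∈ v∈F₀ → members∉F (fn j) (there v∈) (F₀⊆F j v∈F₀) }
          ; sink∉block = λ { j (inj₁ i) v∈ → lead∉taken i v∈ (member-taken j (here refl))
                           ; j (inj₂ j′) v∈ → sink∉ (fn j) (subst (λ i → sink (fn j) ∈ feeders (fn i)) (disjoint (there v∈) (here refl)) v∈) }
          ; block-disjoint = λ {s} {t} → block-disjoint {s} {t}
          ; block≤2 = λ { (inj₁ _) → ≤-refl ; (inj₂ j) → feeders≤ (fn j) }
          }

    -- The budget counts, from left to right, the vertices z, the vertices x̂, three members for
    -- each of 3k funnels, and `F₀`.
    approaches : (∀ F → length F < K → ∃ λ (v : V) → v ∉ F) →
      ∀ (x : Fin k → V) F₀ → k + (k + (3 * k * 3 + length F₀)) ≤ B → Approach R m x F₀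
    approaches fresh x F₀ budget =
      let m*3+F₀≤B = m+n≤o⇒n≤o k (m+n≤o⇒n≤o k budget)
          fs = funnels B m F₀ (λ F F≤B → fresh F (≤-<-trans F≤B B<K)) m*3+F₀≤B
          x̂ , x→x̂ , x̂-inj , x̂∉taken = distinctRepresentatives B k (R ∘ x)
             (λ i L L≤B → escape (x i) L (≤-<-trans L≤B B<K)) (taken fs)
             (≤-trans (+-monoʳ-≤ k (taken≤ fs)) (≤-trans (m+n≤o⇒n≤o k budget) (n≤1+n B)))
          z , good , z-inj , z∉ = distinctRepresentatives B k (λ i z → R (x̂ i) z × length (exceptions fs z) ≤ k)
             (λ i L L≤B → good-exit fs (x̂∉taken i) L≤B) (tabulate x̂ ++ taken fs)
             (≤-trans (+-monoʳ-≤ k (≤-trans (≤-reflexive (trans (length-++ (tabulate x̂))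
                                                                (cong (_+ length (taken fs)) (length-tabulate x̂))))
                                            (+-monoʳ-≤ k (taken≤ fs))))
                      (≤-trans budget (n≤1+n B)))
      in assemble fs x→x̂ x̂-inj x̂∉taken good z-inj z∉

-- Linking

terminals : ∀ {n k} (x y : Fin k → Fin n) → List (Fin n)
terminals x y = tabulate x ++ tabulate y

length-terminals : ∀ {n k} (x y : Fin k → Fin n) → length (terminals x y) ≡ k + k
length-terminals x y = trans (length-++ (tabulate x)) (cong₂ _+_ (length-tabulate x) (length-tabulate y))

module _ {n k m : ℕ} {R : Fin n → Fin n → Set} {x : Fin k → Fin n} {F₀ : List (Fin n)} (a : Approach R m x F₀) where
  open Approach a

  blocks : List (Fin n)
  blocks = concat (tabulate (block ∘ inj₁)) ++ concat (tabulate (block ∘ inj₂))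

  block⊆blocks : ∀ t → block t ⊆ blocks
  block⊆blocks (inj₁ i) v∈ = ∈-++⁺ˡ (∈-concat-tabulate (block ∘ inj₁) i v∈)
  block⊆blocks (inj₂ j) v∈ = ∈-++⁺ʳ (concat (tabulate (block ∘ inj₁))) (∈-concat-tabulate (block ∘ inj₂) j v∈)

  ∈-blocks⁻ : ∀ {v} → v ∈ blocks → ∃ λ t → v ∈ block t
  ∈-blocks⁻ v∈ with ∈-++⁻ (concat (tabulate (block ∘ inj₁))) v∈
  ... | inj₁ v∈₁ with l , v∈l , l∈ ← ∈-concat⁻′ (tabulate (block ∘ inj₁)) v∈₁
                 with i , refl ← ∈-tabulate⁻ l∈ = inj₁ i , v∈l
  ... | inj₂ v∈₂ with l , v∈l , l∈ ← ∈-concat⁻′ (tabulate (block ∘ inj₂)) v∈₂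
                 with j , refl ← ∈-tabulate⁻ l∈ = inj₂ j , v∈l

  length-blocks : length blocks ≤ k * 2 + m * 2
  length-blocks = ≤-trans (≤-reflexive (length-++ (concat (tabulate (block ∘ inj₁)))))
    (+-mono-≤ (length-concat-tabulate k _ (block≤2 ∘ inj₁)) (length-concat-tabulate m _ (block≤2 ∘ inj₂)))

  occupied : List (Fin n)
  occupied = tabulate sink ++ blocks ++ F₀

  length-occupied : length occupied ≤ m + ((k * 2 + m * 2) + length F₀)
  length-occupied = ≤-trans
    (≤-reflexive (trans (length-++ (tabulate sink)) (cong₂ _+_ (length-tabulate sink) (length-++ blocks))))
    (+-monoʳ-≤ m (+-monoˡ-≤ (length F₀) length-blocks))

-- S may have repetitions here, so that concatenated lists can be removed directly;
-- `stronglyConnected⇒connected` deduplicates once and for all.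
Connected : ∀ {n} → (Fin n → Fin n → Set) → ℕ → Set
Connected E K = ∀ S → length S < K → ∀ {u v} → u ∉ S → v ∉ S →
                ∃ λ l → Route E u v l × (∀ {w} → w ∈ l → w ∉ S)

module _ {n : ℕ} (E : Fin n → Fin n → Set) (E? : ∀ u v → Dec (E u v)) (Z : List (Fin n)) where

  Avoiding : Fin n × Fin n → Set
  Avoiding (u , v) = E u v × u ∉ Z × v ∉ Z

  avoiding? : ∀ e → Dec (Avoiding e)
  avoiding? (u , v) = E? u v ×-dec (u ∉? Z ×-dec v ∉? Z)

  arcsAvoiding : List (Fin n × Fin n)
  arcsAvoiding = filter avoiding? (cartesianProduct (allFin n) (allFin n))

  arc⁻ : ∀ {u v} → EdgeIn arcsAvoiding u v → Avoiding (u , v)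
  arc⁻ e = proj₂ (∈-filter⁻ avoiding? {xs = cartesianProduct (allFin n) (allFin n)} e)

  -- Arcs meeting Z are deleted but its vertices stay, as isolated ones, so it is enough that the
  -- start is outside Z.
  route-avoids : ∀ {u v l} → u ∉ Z → Route (EdgeIn arcsAvoiding) u v l → ∀ {w} → w ∈ l → w ∉ Z
  route-avoids u∉Z stop    (here refl) = u∉Z
  route-avoids u∉Z (e ◅ r) (here refl) = u∉Z
  route-avoids u∉Z (e ◅ r) (there w∈)  = route-avoids (proj₂ (proj₂ (arc⁻ e))) r w∈

  restrict : ∀ {u v l} → Route E u v l → (∀ {w} → w ∈ l → w ∉ Z) → Route (EdgeIn arcsAvoiding) u v l
  restrict stop    _     = stop
  restrict (e ◅ r) avoid =
    ∈-filter⁺ avoiding? (∈-cartesianProduct⁺ (∈-allFin _) (∈-allFin _)) (e , avoid (here refl) , avoid (there (source∈ r)))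
    ◅ restrict r (avoid ∘ there)

  -- A separator S with fewer than m vertices misses some u in A and some v in B. Together with Z it
  -- has fewer than K vertices, so connectivity still joins u to v, and this route refutes S.
  linkage : ∀ {K A B m} → Connected E K → Unique A → Unique B → m ≤ length A → m ≤ length B →
            (∀ {v} → v ∈ A → v ∉ Z) → (∀ {v} → v ∈ B → v ∉ Z) → m + length Z ≤ K →
            Linkage arcsAvoiding A B m
  linkage {K} {A} {B} {m} conn uA uB m≤A m≤B A∉Z B∉Z m+Z≤K with menger arcsAvoiding A B m
  ... | inj₂ L = L
  ... | inj₁ (S , S<m , sep)
    with u , u∈A , u∉S ← ∃-outside S uA (<-≤-trans S<m m≤A)
    with v , v∈B , v∉S ← ∃-outside S uB (<-≤-trans S<m m≤B)
    with l , r , avoid ← conn (S ++ Z)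
           (≤-trans (≤-trans (≤-reflexive (cong suc (length-++ S))) (+-monoˡ-≤ (length Z) S<m)) m+Z≤K)
           ([ u∉S , A∉Z u∈A ]′ ∘ ∈-++⁻ S) ([ v∉S , B∉Z v∈B ]′ ∘ ∈-++⁻ S)
    with s , s∈l , s∈S ← sep u∈A v∈B (restrict r (λ w∈ w∈Z → avoid w∈ (∈-++⁺ʳ S w∈Z)))
    = contradiction (∈-++⁺ˡ s∈S) (avoid s∈l)

module _ {n K : ℕ} (K<n : K < n) where

  fresh : ∀ F → length F < K → ∃ λ (v : Fin n) → v ∉ F
  fresh F F<K =
    let v , _ , v∉F = ∃-outside F (Unique.allFin⁺ n) (<-trans F<K (<-≤-trans K<n (≤-reflexive (sym (length-tabulate {n = n} id)))))
    in v , v∉F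

  -- The first step of a route to some vertex outside `x ∷ F` is the required arc. Since F may
  -- contain x, only F without x is removed; irreflexivity shows that the step does not return to x.
  escape : ∀ {E : Fin n → Fin n → Set} → (∀ {v} → ¬ E v v) → Connected E K → ∀ x F → length F < K → ∃ λ v → E x v × v ∉ F
  escape {E} irr conn x F F<K
    with u , _ , u∉ ← ∃-outside (x ∷ F) (Unique.allFin⁺ n) (≤-<-trans F<K (<-≤-trans K<n (≤-reflexive (sym (length-tabulate {n = n} id)))))
    with l , r , avoid ← conn (filter (λ v → ¬? (v ≟ x)) F) (≤-<-trans (length-filter (λ v → ¬? (v ≟ x)) F) F<K)
           (λ x∈ → proj₂ (∈-filter⁻ (λ v → ¬? (v ≟ x)) {xs = F} x∈) refl)
           (λ u∈ → u∉ (there (proj₁ (∈-filter⁻ (λ v → ¬? (v ≟ x)) u∈))))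
    = first-step r avoid
    where
    first-step : ∀ {l} → Route E x u l → (∀ {w} → w ∈ l → w ∉ filter (λ v → ¬? (v ≟ x)) F) → ∃ λ v → E x v × v ∉ F
    first-step stop _ = contradiction (here refl) u∉
    first-step (e ◅ r) avoid = _ , e , λ v∈F →
      avoid (there (source∈ r)) (∈-filter⁺ (λ v → ¬? (v ≟ x)) v∈F λ { refl → irr e })

connected-flip : ∀ {n K} {E : Fin n → Fin n → Set} → Connected E K → Connected (flip E) K
connected-flip conn S S<K u∉S v∉S =
  let l , r , avoid = conn S S<K v∉S u∉S
      l′ , r′ , l′⊆l = reverse-route r
  in l′ , r′ , avoid ∘ l′⊆l

-- Disjointness of the final paths splits into two facts: a vertex lies in at most one region, and a
-- region belongs to at most one path. Sinks need no region of their own, since they lie on links.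
data Region (k m : ℕ) : Set where
  ends              : Fin k → Region k m
  leaving entering  : Fin k ⊎ Fin m → Region k m
  link              : Fin m → Region k m

module Linking {n k : ℕ} (E : Fin n → Fin n → Set) (E? : ∀ u v → Dec (E u v)) {K : ℕ}
  (conn : Connected E K) (21k≤K : 21 * k ≤ K) (0<k : 0 < k)
  {x y : Fin k → Fin n} (x-inj : Injective _≡_ _≡_ x) (y-inj : Injective _≡_ _≡_ y) (x≢y : ∀ i j → x i ≢ y j)
  (M : Approach E (3 * k) x (terminals x y)) (P : Approach (flip E) (3 * k) y (occupied M)) where

  private
    m : ℕ
    m = 3 * k

    F₀ : List (Fin n)
    F₀ = terminals x y

  module M = Approach M
  module P = Approach P

  -- The sinks are left out, being the ends of the links.
  Z : List (Fin n)
  Z = blocks M ++ blocks P ++ F₀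

  x∈F₀ : ∀ i → x i ∈ F₀
  x∈F₀ i = ∈-++⁺ˡ (∈-tabulate⁺ i)

  y∈F₀ : ∀ i → y i ∈ F₀
  y∈F₀ i = ∈-++⁺ʳ (tabulate x) (∈-tabulate⁺ i)

  F₀⊆Z : F₀ ⊆ Z
  F₀⊆Z = ∈-++⁺ʳ (blocks M) ∘ ∈-++⁺ʳ (blocks P)

  blocks⊆occupied : blocks M ⊆ occupied M
  blocks⊆occupied = ∈-++⁺ʳ (tabulate M.sink) ∘ ∈-++⁺ˡ

  F₀⊆occupied : F₀ ⊆ occupied M
  F₀⊆occupied = ∈-++⁺ʳ (tabulate M.sink) ∘ ∈-++⁺ʳ (blocks M)

  ∉Z : ∀ {v} → (∀ t → v ∉ M.block t) → (∀ t → v ∉ P.block t) → v ∉ F₀ → v ∉ Z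
  ∉Z ∉M ∉P ∉F₀ v∈ with ∈-++⁻ (blocks M) v∈
  ... | inj₁ v∈M = let t , v∈t = ∈-blocks⁻ M v∈M in ∉M t v∈t
  ... | inj₂ v∈′ with ∈-++⁻ (blocks P) v∈′
  ...   | inj₁ v∈P  = let t , v∈t = ∈-blocks⁻ P v∈P in ∉P t v∈t
  ...   | inj₂ v∈F₀ = ∉F₀ v∈F₀

  M-sink∉Z : ∀ {v} → v ∈ tabulate M.sink → v ∉ Z
  M-sink∉Z v∈ with j , refl ← ∈-tabulate⁻ v∈ =
    ∉Z (M.sink∉block j) (λ t s∈ → P.block∉F₀ t s∈ (∈-++⁺ˡ v∈)) (M.sink∉F₀ j)

  P-sink∉Z : ∀ {v} → v ∈ tabulate P.sink → v ∉ Z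
  P-sink∉Z v∈ with j , refl ← ∈-tabulate⁻ v∈ =
    ∉Z (λ t s∈ → P.sink∉F₀ j (blocks⊆occupied (block⊆blocks M t s∈))) (P.sink∉block j) (P.sink∉F₀ j ∘ F₀⊆occupied)

  m+Z≤K : m + length Z ≤ K
  m+Z≤K = begin
    m + length Z
      ≡⟨ cong (m +_) (trans (length-++ (blocks M)) (cong (length (blocks M) +_) (length-++ (blocks P)))) ⟩
    m + (length (blocks M) + (length (blocks P) + length F₀))
      ≤⟨ +-monoʳ-≤ m (+-mono-≤ (length-blocks M) (+-mono-≤ (length-blocks P) (≤-reflexive (length-terminals x y)))) ⟩
    m + ((k * 2 + m * 2) + ((k * 2 + m * 2) + (k + k)))
      ≡⟨ total k ⟩
    21 * k
      ≤⟨ 21k≤K ⟩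
    K ∎
    where
    open ≤-Reasoning
    total : ∀ k → 3 * k + ((k * 2 + 3 * k * 2) + ((k * 2 + 3 * k * 2) + (k + k))) ≡ 21 * k
    total = solve-∀

  sinkLinkage : Linkage (arcsAvoiding E E? Z) (tabulate M.sink) (tabulate P.sink) m
  sinkLinkage = linkage E E? Z conn (Unique.tabulate⁺ M.sink-injective) (Unique.tabulate⁺ P.sink-injective)
                  (≤-reflexive (sym (length-tabulate M.sink))) (≤-reflexive (sym (length-tabulate P.sink)))
                  M-sink∉Z P-sink∉Z m+Z≤K

  module Routing (L : Linkage (arcsAvoiding E E? Z) (tabulate M.sink) (tabulate P.sink) m) where

    module L = Linkage L

    link-of : ∀ j → ∃ λ i → L.src i ≡ M.sink j
    link-of j = injective⇒covers L.src-injective L.src∈ (≤-reflexive (length-tabulate M.sink)) (∈-tabulate⁺ j)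

    -- `ρ` sends a sink to the link starting there; `σ` below sends it to the dual sink at the other
    -- end of that link.
    ρ : Fin m → Fin m
    ρ = proj₁ ∘ link-of

    ρ-injective : Injective _≡_ _≡_ ρ
    ρ-injective {i} {j} eq = M.sink-injective (trans (sym (proj₂ (link-of i))) (trans (cong L.src eq) (proj₂ (link-of j))))

    end-of : ∀ j → ∃ λ i → L.tgt (ρ j) ≡ P.sink i
    end-of j = ∈-tabulate⁻ (L.tgt∈ (ρ j))

    σ : Fin m → Fin m
    σ = proj₁ ∘ end-of

    σ-injective : Injective _≡_ _≡_ σ
    σ-injective {i} {j} eq = ρ-injective (L.tgt-injective
      (trans (proj₂ (end-of i)) (trans (cong P.sink eq) (sym (proj₂ (end-of j))))))

    link-avoids : ∀ {j w} → w ∈ L.verts j → w ∉ Z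
    link-avoids {j} = route-avoids E E? Z (M-sink∉Z (L.src∈ j)) (L.route j)

    link-route : ∀ j → Route E (M.sink j) (P.sink (σ j)) (L.verts (ρ j))
    link-route j = subst₂ (λ u v → Route E u v (L.verts (ρ j))) (proj₂ (link-of j)) (proj₂ (end-of j))
      (route-map (proj₁ ∘ arc⁻ E E? Z) (L.route (ρ j)))

    Suitable : Fin k → Fin m → Set
    Suitable i j = j ∉ M.bad i × σ j ∉ P.bad i

    -- At most k links are bad at x i, at most k at y i because `σ` is injective, and at most k - 1
    -- are in F: fewer than 3k altogether.
    suitable : ∀ i F → length F ≤ pred k → ∃ λ j → Suitable i j × j ∉ F
    suitable i F F≤ =
      let j , _ , j∉ = ∃-outside (M.bad i ++ badEnd ++ F) (Unique.allFin⁺ m) few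
      in j , (j∉ ∘ ∈-++⁺ˡ , (λ σj∈ → j∉ (∈-++⁺ʳ (M.bad i) (∈-++⁺ˡ (∈-filter⁺ (λ j → σ j ∈? P.bad i) (∈-allFin j) σj∈)))))
           , j∉ ∘ ∈-++⁺ʳ (M.bad i) ∘ ∈-++⁺ʳ badEnd
      where
      open ≤-Reasoning
      badEnd : List (Fin m)
      badEnd = filter (λ j → σ j ∈? P.bad i) (allFin m)
      badEnd≤k : length badEnd ≤ k
      badEnd≤k = begin
        length badEnd         ≡⟨ length-map σ badEnd ⟨
        length (map σ badEnd) ≤⟨ unique-⊆⇒length≤ (Unique.map⁺ σ-injective (Unique.filter⁺ (λ j → σ j ∈? P.bad i) (Unique.allFin⁺ m))) mapped ⟩
        length (P.bad i)      ≤⟨ P.bad≤ i ⟩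
        k                     ∎
        where
        mapped : map σ badEnd ⊆ P.bad i
        mapped v∈ with j , j∈ , refl ← ∈-map⁻ σ v∈ = proj₂ (∈-filter⁻ (λ j → σ j ∈? P.bad i) {xs = allFin m} j∈)
      few : length (M.bad i ++ badEnd ++ F) < length (allFin m)
      few = begin-strict
        length (M.bad i ++ badEnd ++ F)
          ≡⟨ trans (length-++ (M.bad i)) (cong (length (M.bad i) +_) (length-++ badEnd)) ⟩
        length (M.bad i) + (length badEnd + length F)
          <⟨ +-mono-≤-< (M.bad≤ i) (+-mono-≤-< badEnd≤k (≤-<-trans F≤ (≤-reflexive (suc-pred k {{>-nonZero 0<k}})))) ⟩
        k + (k + k)
          ≡⟨ cong (λ l → k + (k + l)) (sym (+-identityʳ k)) ⟩
        m
          ≡⟨ length-tabulate {n = m} id ⟨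
        length (allFin m) ∎

    assignment : ∃ λ (τ : Fin k → Fin m) → (∀ i → Suitable i (τ i)) × Injective _≡_ _≡_ τ × (∀ i → τ i ∉ [])
    assignment = distinctRepresentatives (pred k) k Suitable suitable []
      (≤-reflexive (trans (+-identityʳ k) (sym (suc-pred k {{>-nonZero 0<k}}))))

    module Assigned {τ : Fin k → Fin m} (suitable-τ : ∀ i → Suitable i (τ i)) (τ-injective : Injective _≡_ _≡_ τ) where

      In : Region k m → Fin n → Set
      In (ends i)     w = w ≡ x i ⊎ w ≡ y i
      In (leaving t)  w = w ∈ M.block t
      In (entering t) w = w ∈ P.block t
      In (link j)     w = w ∈ L.verts j

      Owns : Fin k → Region k m → Set
      Owns i (ends j)            = j ≡ i
      Owns i (leaving (inj₁ j))  = j ≡ i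
      Owns i (leaving (inj₂ j))  = j ≡ τ i
      Owns i (entering (inj₁ j)) = j ≡ i
      Owns i (entering (inj₂ j)) = j ≡ σ (τ i)
      Owns i (link j)            = j ≡ ρ (τ i)

      owner-unique : ∀ {i i′} a → Owns i a → Owns i′ a → i ≡ i′
      owner-unique (ends _)            p q = trans (sym p) q
      owner-unique (leaving (inj₁ _))  p q = trans (sym p) q
      owner-unique (leaving (inj₂ _))  p q = τ-injective (trans (sym p) q)
      owner-unique (entering (inj₁ _)) p q = trans (sym p) q
      owner-unique (entering (inj₂ _)) p q = τ-injective (σ-injective (trans (sym p) q))
      owner-unique (link _)            p q = τ-injective (ρ-injective (trans (sym p) q))

      ends∈F₀ : ∀ i {w} → In (ends i) w → w ∈ F₀
      ends∈F₀ i (inj₁ refl) = x∈F₀ i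
      ends∈F₀ i (inj₂ refl) = y∈F₀ i

      ends-disjoint : ∀ {i j w} → In (ends i) w → In (ends j) w → i ≡ j
      ends-disjoint (inj₁ p) (inj₁ q) = x-inj (trans (sym p) q)
      ends-disjoint (inj₁ p) (inj₂ q) = contradiction (trans (sym p) q) (x≢y _ _)
      ends-disjoint (inj₂ p) (inj₁ q) = contradiction (trans (sym q) p) (x≢y _ _)
      ends-disjoint (inj₂ p) (inj₂ q) = y-inj (trans (sym p) q)

      leaving∉ends : ∀ t i {w} → In (leaving t) w → ¬ In (ends i) w
      leaving∉ends t i p q = M.block∉F₀ t p (ends∈F₀ i q)

      entering∉ends : ∀ t i {w} → In (entering t) w → ¬ In (ends i) w
      entering∉ends t i p q = P.block∉F₀ t p (F₀⊆occupied (ends∈F₀ i q))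

      entering∉leaving : ∀ t s {w} → In (entering t) w → ¬ In (leaving s) w
      entering∉leaving t s p q = P.block∉F₀ t p (blocks⊆occupied (block⊆blocks M s q))

      link∉ends : ∀ j i {w} → In (link j) w → ¬ In (ends i) w
      link∉ends j i p q = link-avoids p (F₀⊆Z (ends∈F₀ i q))

      link∉leaving : ∀ j t {w} → In (link j) w → ¬ In (leaving t) w
      link∉leaving j t p q = link-avoids p (∈-++⁺ˡ (block⊆blocks M t q))

      link∉entering : ∀ j t {w} → In (link j) w → ¬ In (entering t) w
      link∉entering j t p q = link-avoids p (∈-++⁺ʳ (blocks M) (∈-++⁺ˡ (block⊆blocks P t q)))

      region-unique : ∀ a b {w} → In a w → In b w → a ≡ b
      region-unique (ends i)     (ends j)     p q = cong ends (ends-disjoint p q)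
      region-unique (leaving s)  (leaving t)  p q = cong leaving (M.block-disjoint p q)
      region-unique (entering s) (entering t) p q = cong entering (P.block-disjoint p q)
      region-unique (link i)     (link j)     p q = cong link (L.disjoint p q)
      region-unique (ends i)     (leaving t)  p q = contradiction p (leaving∉ends t i q)
      region-unique (ends i)     (entering t) p q = contradiction p (entering∉ends t i q)
      region-unique (ends i)     (link j)     p q = contradiction p (link∉ends j i q)
      region-unique (leaving t)  (ends i)     p q = contradiction q (leaving∉ends t i p)
      region-unique (leaving t)  (entering s) p q = contradiction p (entering∉leaving s t q)
      region-unique (leaving t)  (link j)     p q = contradiction p (link∉leaving j t q)
      region-unique (entering t) (ends i)     p q = contradiction q (entering∉ends t i p)
      region-unique (entering t) (leaving s)  p q = contradiction q (entering∉leaving t s p)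
      region-unique (entering t) (link j)     p q = contradiction p (link∉entering j t q)
      region-unique (link j)     (ends i)     p q = contradiction q (link∉ends j i p)
      region-unique (link j)     (leaving t)  p q = contradiction q (link∉leaving j t p)
      region-unique (link j)     (entering t) p q = contradiction q (link∉entering j t p)

      OnPath : Fin k → Fin n → Set
      OnPath i w = ∃ λ a → Owns i a × In a w

      path : ∀ i → ∃ λ l → Route E (x i) (y i) l × Unique l × (∀ {w} → w ∈ l → OnPath i w)
      path i =
        let τi∉M , στi∉P = suitable-τ i
            l₁ , r₁ , l₁⊆ = M.approach i τi∉M
            l₃ , r₃ , l₃⊆ = P.approach i στi∉P
            -- The dual approach runs from `y i` in the reversed tournament, so reversing it gives a
            -- route of E into `y i`.
            l₃′ , r₃′ , l₃′⊆ = reverse-route r₃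
            l₂₃ , r₂₃ , l₂₃⊆ = join (link-route (τ i)) r₃′
            l₁₂₃ , r₁₂₃ , l₁₂₃⊆ = join r₁ r₂₃
            l , r , l⊆ , uniq = shorten r₁₂₃
        in l , r , uniq , λ w∈ → case ∈-++⁻ l₁ (l₁₂₃⊆ (l⊆ w∈)) of λ
          { (inj₁ w∈₁)  → onLeaving (l₁⊆ w∈₁)
          ; (inj₂ w∈₂₃) → [ onLink , onEntering ∘ l₃⊆ ∘ l₃′⊆ ]′ (∈-++⁻ (L.verts (ρ (τ i))) (l₂₃⊆ w∈₂₃)) }
        where
        onLink : ∀ {w} → w ∈ L.verts (ρ (τ i)) → OnPath i w
        onLink w∈ = link (ρ (τ i)) , refl , w∈
        onLeaving : ∀ {w} → w ∈ x i ∷ M.sink (τ i) ∷ M.block (inj₁ i) ++ M.block (inj₂ (τ i)) → OnPath i w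
        onLeaving (here refl)         = ends i , refl , inj₁ refl
        onLeaving (there (here refl)) = onLink (source∈ (link-route (τ i)))
        onLeaving (there (there w∈))  = [ (λ p → leaving (inj₁ i) , refl , p) , (λ p → leaving (inj₂ (τ i)) , refl , p) ]′
                                          (∈-++⁻ (M.block (inj₁ i)) w∈)
        onEntering : ∀ {w} → w ∈ y i ∷ P.sink (σ (τ i)) ∷ P.block (inj₁ i) ++ P.block (inj₂ (σ (τ i))) → OnPath i w
        onEntering (here refl)         = ends i , refl , inj₂ refl
        onEntering (there (here refl)) = onLink (target∈ (link-route (τ i)))
        onEntering (there (there w∈))  = [ (λ p → entering (inj₁ i) , refl , p) , (λ p → entering (inj₂ (σ (τ i))) , refl , p) ]′
                                           (∈-++⁻ (P.block (inj₁ i)) w∈)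

      onPath-unique : ∀ i j {w} → OnPath i w → OnPath j w → i ≡ j
      onPath-unique i j (a , i-owns-a , w∈a) (b , j-owns-b , w∈b) with refl ← region-unique a b w∈a w∈b =
        owner-unique a i-owns-a j-owns-b

-- Passage to the given notions, and the constants

module _ {D : Digraph} where

  walk⇒route : ∀ {u l} → Walk D (u ∷ l) → Route (Arc D) u (last u l) (u ∷ l)
  walk⇒route (single _) = stop
  walk⇒route (step e w) = e ◅ walk⇒route w

  route⇒walk : ∀ {u v l} → Route (Arc D) u v l → Walk D l
  route⇒walk stop              = single _
  route⇒walk (e ◅ stop)        = step e (single _)
  route⇒walk (e ◅ r@(_ ◅ _))   = step e (route⇒walk r)

  last-route : ∀ {u v l} d → Route (Arc D) u v l → last d l ≡ v
  last-route d stop    = refl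
  last-route d (_ ◅ r) = last-route _ r

  head-route : ∀ {u v l} → Route (Arc D) u v l → Σ (List (Fin (n D))) λ rest → l ≡ u ∷ rest
  head-route stop    = _ , refl
  head-route (_ ◅ _) = _ , refl

  route⇒path : ∀ {u v l} → Route (Arc D) u v l → Unique l → IsPath D u v l
  route⇒path r uniq = head-route r , last-route _ r , uniq , route⇒walk r

  stronglyConnected⇒connected : ∀ {K} → StronglyConnectedK K D → Connected (Arc D) K
  stronglyConnected⇒connected {K} (_ , strong) S S<K u∉S v∉S
    with l , ((_ , refl) , refl , _ , w) , avoid ← strong (deduplicate _≟_ S) (deduplicate-! _≟_ S)
           (≤-trans (unique-⊆⇒length≤ (deduplicate-! _≟_ S) (∈-deduplicate⁻ _≟_ S)) (∸-monoˡ-≤ 1 S<K))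
           _ _ (u∉S ∘ ∈-deduplicate⁻ _≟_ S) (v∉S ∘ ∈-deduplicate⁻ _≟_ S)
    = l , walk⇒route w , λ w∈ w∈S → All.lookup avoid w∈ (∈-deduplicate⁺ _≟_ w∈S)

theorem1p5 : (k : ℕ) → 1 ≤ k → (D : Digraph) → IsTournament D →
    StronglyConnectedK (452 * k) D → KLinked k D
theorem1p5 k 1≤k D (irrefl , total , asym) strong@(K<n , _) x y x-inj y-inj x≢y =
  (λ i → proj₁ (path i)) ,
  (λ i → let _ , r , uniq , _ = path i in route⇒path r uniq) ,
  (λ i j i≢j w w∈i w∈j →
    let _ , _ , _ , on-i = path i
        _ , _ , _ , on-j = path j
    in i≢j (onPath-unique i j (on-i w∈i) (on-j w∈j)))
  where
  -- `Arc` is an arbitrary family of sets; irreflexivity, totality and asymmetry together decide it.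
  arc? : ∀ u v → Dec (Arc D u v)
  arc? u v with u ≟ v
  ... | yes refl = no (irrefl u)
  ... | no  u≢v with total u v u≢v
  ...   | inj₁ u→v = yes u→v
  ...   | inj₂ v→u = no (asym v u v→u)

  conn : Connected (Arc D) (452 * k)
  conn = stronglyConnected⇒connected strong

  instance
    k≢0 : NonZero k
    k≢0 = >-nonZero 1≤k

  -- The common budget `24 * k` is the one that `P` requires; 356 completes 4 times 24 to 452.
  4B≤K : 4 * (24 * k) ≤ 452 * k
  4B≤K = ≤-trans (≤-reflexive (sym (*-assoc 4 24 k))) (*-monoˡ-≤ k (m≤m+n 96 356))

  B<K : 24 * k < 452 * k
  B<K = *-monoˡ-< k (m≤m+n 25 427)

  M : Approach (Arc D) (3 * k) x (terminals x y)
  M = Tournament.approaches (Arc D) arc? (λ {u} {v} → asym u v) (λ {u} {v} → total u v)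
        (452 * k) (24 * k) k
        (escape K<n (λ {v} → irrefl v) conn)
        4B≤K B<K (fresh K<n) x (terminals x y)
        (begin
          k + (k + (3 * k * 3 + length (terminals x y))) ≡⟨ cong (λ l → k + (k + (3 * k * 3 + l))) (length-terminals x y) ⟩
          k + (k + (3 * k * 3 + (k + k)))                ≡⟨ total-length k ⟩
          13 * k                                         ≤⟨ *-monoˡ-≤ k (m≤m+n 13 11) ⟩
          24 * k                                         ∎)
    where
    open ≤-Reasoning
    total-length : ∀ k → k + (k + (3 * k * 3 + (k + k))) ≡ 13 * k
    total-length = solve-∀

  -- Here `F₀` is all of `occupied M`, so the two constructions are disjoint; 24 is the sum of 1, 1,
  -- 9, 3, 8 and 2.
  P : Approach (flip (Arc D)) (3 * k) y (occupied M)
  P = Tournament.approaches (flip (Arc D)) (flip arc?) (λ {u} {v} → asym v u) (λ {u} {v} u≢v → total v u (u≢v ∘ sym))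
        (452 * k) (24 * k) k
        (escape K<n (λ {v} → irrefl v) (connected-flip conn))
        4B≤K B<K (fresh K<n) y (occupied M)
        (begin
          k + (k + (3 * k * 3 + length (occupied M)))
            ≤⟨ +-monoʳ-≤ k (+-monoʳ-≤ k (+-monoʳ-≤ (3 * k * 3) (length-occupied M))) ⟩
          k + (k + (3 * k * 3 + (3 * k + ((k * 2 + 3 * k * 2) + length (terminals x y)))))
            ≡⟨ cong (λ l → k + (k + (3 * k * 3 + (3 * k + ((k * 2 + 3 * k * 2) + l))))) (length-terminals x y) ⟩
          k + (k + (3 * k * 3 + (3 * k + ((k * 2 + 3 * k * 2) + (k + k)))))
            ≡⟨ total-length k ⟩
          24 * k ∎)
    where
    open ≤-Reasoning
    total-length : ∀ k → k + (k + (3 * k * 3 + (3 * k + ((k * 2 + 3 * k * 2) + (k + k))))) ≡ 24 * k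
    total-length = solve-∀

  21k≤K : 21 * k ≤ 452 * k
  21k≤K = *-monoˡ-≤ k (m≤m+n 21 431)

  x-injective : Injective _≡_ _≡_ x
  x-injective = x-inj _ _

  y-injective : Injective _≡_ _≡_ y
  y-injective = y-inj _ _

  open Linking (Arc D) arc? conn 21k≤K 1≤k x-injective y-injective x≢y M P
  open Routing sinkLinkage
  open Assigned (proj₁ (proj₂ assignment)) (proj₁ (proj₂ (proj₂ assignment)))
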